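{- If $L$ is a finite distributive lattice with $\chi_D(Q_L)\ge 3$, then $\chi_D(L)\le |Q_L|+\chi_D(Q_L)-1$.
   Context: A point of a lattice is join-irreducible if in the Hasse diagram it has exactly one downward edge; $Q_L$ is the subposet induced by the join-irreducible points of $L$. For a finite poset $P$, a coloring is proper if comparable points get different colors and distinguishing if the only color-preserving automorphism is the identity; $\chi_D(P)$ is the least number of colors in a proper distinguishing coloring of $P$. -}

module Defs where

open import Data.Nat using (ℕ; _≤_)
open import Data.Fin using (Fin)
open import Data.Fin.Properties using (_≟_; any?; all?)
open import Data.Product using (Σ; ∃; _×_; _,_; proj₁; proj₂)
open import Data.Sum using (_⊎_)
open import Data.List using (List; length; filter; allFin)
open import Data.Fin.Base using ()
open import Data.List using () renaming (map to lmap)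
open import Function using (_⇔_; _∘_)
open import Relation.Nullary using (¬_; Dec; yes; no; _×-dec_; ¬?)
open import Relation.Nullary.Decidable using (True; map′)
import Relation.Binary.PropositionalEquality
open Relation.Binary.PropositionalEquality using (_≡_; _≢_; refl; sym; trans; cong)
open import Relation.Binary.Lattice.Structures using (IsDistributiveLattice)
open import Data.Vec.Functional using ()
import Data.Fin as F

module _ {A : Set} (_⊑_ : A → A → Set) where

  Comparable : A → A → Set
  Comparable x y = (x ⊑ y) ⊎ (y ⊑ x)

  IsAutomorphism : (A → A) → Set
  IsAutomorphism f =
    (∀ x y → f x ≡ f y → x ≡ y) ×
    (∀ y → ∃ λ x → f x ≡ y) ×
    (∀ x y → (x ⊑ y) ⇔ (f x ⊑ f y))

  Proper : (k : ℕ) → (A → Fin k) → Set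
  Proper k c = ∀ x y → x ≢ y → Comparable x y → c x ≢ c y

  Distinguishing : (k : ℕ) → (A → Fin k) → Set
  Distinguishing k c =
    ∀ f → IsAutomorphism f → (∀ x → c (f x) ≡ c x) → ∀ x → f x ≡ x

  IsChiD : ℕ → Set
  IsChiD k =
    (Σ (A → Fin k) λ c → Proper k c × Distinguishing k c) ×
    (∀ j (c : A → Fin j) → Proper j c → Distinguishing j c → k ≤ j)

record FinDistLattice : Set₁ where
  field
    n      : ℕ
    _≼_    : Fin n → Fin n → Set
    _∨_    : Fin n → Fin n → Fin n
    _∧_    : Fin n → Fin n → Fin n
    isDistributiveLattice : IsDistributiveLattice _≡_ _≼_ _∨_ _∧_

  open IsDistributiveLattice isDistributiveLattice public
    using (x≤x∨y; y≤x∨y; ∨-least; antisym)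

  _≺_ : Fin n → Fin n → Set
  x ≺ y = (x ≼ y) × (x ≢ y)

  _⋖_ : Fin n → Fin n → Set
  x ⋖ y = (x ≺ y) × (∀ z → ¬ ((x ≺ z) × (z ≺ y)))

  JoinIrreducible : Fin n → Set
  JoinIrreducible x = Σ (Fin n) λ y → (y ⋖ x) × (∀ z → z ⋖ x → z ≡ y)

  -- decidability (the order is decidable since x ≼ y iff x ∨ y ≡ y)
  ≼-dec : ∀ x y → Dec (x ≼ y)
  ≼-dec x y = map′ (λ e → subst′ e (x≤x∨y x y)) (λ p → antisym (∨-least p (IsDistributiveLattice.refl isDistributiveLattice)) (y≤x∨y x y)) ((x ∨ y) ≟ y)
    where
    subst′ : x ∨ y ≡ y → x ≼ (x ∨ y) → x ≼ y
    subst′ e p = Relation.Binary.PropositionalEquality.subst (x ≼_) e p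

  ≺-dec : ∀ x y → Dec (x ≺ y)
  ≺-dec x y = ≼-dec x y ×-dec ¬? (x ≟ y)

  ⋖-dec : ∀ x y → Dec (x ⋖ y)
  ⋖-dec x y = ≺-dec x y ×-dec all? (λ z → ¬? (≺-dec x z ×-dec ≺-dec z y))

  joinIrreducible? : ∀ x → Dec (JoinIrreducible x)
  joinIrreducible? x =
    any? (λ y → ⋖-dec y x ×-dec all? (λ z → imp (⋖-dec z x) (z ≟ y)))
    where
    imp : ∀ {P Q : Set} → Dec P → Dec Q → Dec (P → Q)
    imp _ (yes q) = yes (λ _ → q)
    imp (no ¬p) _ = yes (λ p → Data.Empty.⊥-elim (¬p p))
      where import Data.Empty
    imp (yes p) (no ¬q) = no (λ f → ¬q (f p))

  QL : Set
  QL = Σ (Fin n) λ x → True (joinIrreducible? x)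

  _≼Q_ : QL → QL → Set
  a ≼Q b = proj₁ a ≼ proj₁ b

  ∣QL∣ : ℕ
  ∣QL∣ = length (filter joinIrreducible? (allFin n))

-- Fix a proper distinguishing colouring of Q_L with classes 0, …, q − 1 and let rank x be the
-- number of join-irreducibles below x, an automorphism-invariant and strictly monotone function.
-- Colour non-join-irreducibles and class 0 by rank, and the other join-irreducibles by class:
-- rank 1 occurs only at atoms, which are join-irreducible, so its colour is saved once the
-- atoms of class 0 get colour 2 instead. This clashes only with the non-join-irreducibles x of
-- rank 2 above an atom of class 0. Such an x gets the colour of class 1, or that of class 2 if
-- an atom of class 1 is also below x (here q ≥ 3 enters), and the join-irreducibles of classes
-- 1 and 2 that would then clash with x are coloured by rank. No distinction between classes is
-- lost: the atoms keep their classes, and the join-irreducible non-atoms coloured by rank are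
-- told apart by the classes of the atoms below them.
module Submission where

open import Defs
open import Data.Nat using (ℕ; _≤_; _+_; _∸_)
open import Data.Nat using (zero; suc; pred; _<_; z≤n; s≤s; s≤s⁻¹)
import Data.Nat as ℕ
import Data.Nat.Properties as ℕₚ
open import Data.Bool.Properties using (T-irrelevant)
open import Data.Fin using (Fin; zero; suc; toℕ; fromℕ<)
open import Data.Fin.Patterns using (0F; 1F; 2F)
open import Data.Fin.Properties
  using (_≟_; any?; toℕ<n; toℕ-injective; fromℕ<-injective; injective⇒≤)
open import Data.Fin.Induction using (spo-wellFounded)
open import Data.List using (List; []; _∷_; length; lookup; filter; allFin)
open import Data.List.Membership.Propositional using (_∈_)
open import Data.List.Membership.Propositional.Properties
  using (∈-filter⁺; ∈-filter⁻; ∈-allFin; ∈-lookup)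
open import Data.List.Relation.Unary.All as All using ([]; _∷_)
open import Data.List.Relation.Unary.AllPairs using ([]; _∷_)
open import Data.List.Relation.Unary.Any using (here; index)
open import Data.List.Relation.Unary.Any.Properties using (lookup-index)
open import Data.List.Relation.Unary.Unique.Propositional using (Unique)
import Data.List.Relation.Unary.Unique.Propositional.Properties as Unique
open import Data.Product using (Σ; ∃; _×_; _,_; proj₁; proj₂)
open import Data.Sum using (inj₁; inj₂)
open import Data.Empty using (⊥)
open import Function using (id; _∘_; mk⇔; Equivalence)
open import Induction.WellFounded using (Acc; acc; WellFounded)
open import Relation.Binary.Lattice.Structures using (IsDistributiveLattice)
import Relation.Binary.Construct.NonStrictToStrict as ToStrict
open import Relation.Nullary using (¬_; Dec; yes; no; contradiction; ¬?; _×-dec_)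
open import Relation.Nullary.Decidable using (True; toWitness; fromWitness; T?; decidable-stable)
open import Relation.Binary.PropositionalEquality
  using (_≡_; _≢_; refl; sym; trans; cong; subst; subst₂)

-- Comparing lengths of lists through injections.

lookup-injective : ∀ {A : Set} {xs : List A} → Unique xs →
  ∀ i j → lookup xs i ≡ lookup xs j → i ≡ j
lookup-injective (_   ∷ _) zero    zero    _ = refl
lookup-injective (x∉ ∷ _) zero    (suc j) e = contradiction e (All.lookup x∉ (∈-lookup j))
lookup-injective (x∉ ∷ _) (suc i) zero    e = contradiction (sym e) (All.lookup x∉ (∈-lookup i))
lookup-injective (_ ∷ u)  (suc i) (suc j) e = cong suc (lookup-injective u i j e)

index-injective : ∀ {A : Set} {x y : A} {xs : List A} (p : x ∈ xs) (q : y ∈ xs) →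
  index p ≡ index q → x ≡ y
index-injective {xs = xs} p q e =
  trans (lookup-index p) (trans (cong (lookup xs) e) (sym (lookup-index q)))

-- Sending each position in `xs` to the position of its image in `ys` gives an injection between
-- finite index types.
length-mono : ∀ {A B : Set} {xs : List A} {ys : List B} (f : A → B) →
  (∀ x y → f x ≡ f y → x ≡ y) → Unique xs → (∀ x → x ∈ xs → f x ∈ ys) →
  length xs ≤ length ys
length-mono {xs = xs} f f-inj uniq f∈ = injective⇒≤ {f = g} g-inj
  where
  f∈′ : ∀ i → f (lookup xs i) ∈ _
  f∈′ i = f∈ _ (∈-lookup i)
  g : Fin (length xs) → Fin _
  g i = index (f∈′ i)
  g-inj : ∀ {i j} → g i ≡ g j → i ≡ j
  g-inj {i} {j} e =
    lookup-injective uniq i j (f-inj _ _ (index-injective (f∈′ i) (f∈′ j) e))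

-- Join-irreducibles and rank.

module Rank (L : FinDistLattice) where
  open FinDistLattice L public
  open IsDistributiveLattice isDistributiveLattice public
    using (isPartialOrder; x∧y≤x; x∧y≤y; ∧-greatest)
    renaming (refl to ≼-refl; trans to ≼-trans)

  ≺-wellFounded : WellFounded _≺_
  ≺-wellFounded = spo-wellFounded (ToStrict.<-isStrictPartialOrder _≡_ _≼_ isPartialOrder)

  -- A minimal z with z ⋠ x is join-irreducible, its unique lower cover being z ∧ x.
  joinIrreducible-separates : ∀ {x y} → ¬ y ≼ x → ∃ λ p → JoinIrreducible p × p ≼ y × ¬ p ≼ x
  joinIrreducible-separates {x} {y} y⋠x = descend y (≺-wellFounded y) ≼-refl y⋠x
    where
    descend : ∀ z → Acc _≺_ z → z ≼ y → ¬ z ≼ x → ∃ λ p → JoinIrreducible p × p ≼ y × ¬ p ≼ x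
    descend z (acc rs) z≼y z⋠x with any? (λ w → ≺-dec w z ×-dec ¬? (≼-dec w x))
    ... | yes (w , w≺z , w⋠x) = descend w (rs w≺z) (≼-trans (proj₁ w≺z) z≼y) w⋠x
    ... | no minimal = z , (z ∧ x , (z∧x≺z , nothing-between) , unique) , z≼y , z⋠x
      where
      z∧x≺z : (z ∧ x) ≺ z
      z∧x≺z = x∧y≤x z x , λ e → z⋠x (subst (_≼ x) e (x∧y≤y z x))
      below : ∀ {w} → w ≺ z → w ≼ (z ∧ x)
      below {w} w≺z = ∧-greatest (proj₁ w≺z)
        (decidable-stable (≼-dec w x) (λ w⋠x → minimal (w , w≺z , w⋠x)))
      nothing-between : ∀ w → ¬ (((z ∧ x) ≺ w) × (w ≺ z))
      nothing-between w ((le , ne) , w≺z) = ne (antisym le (below w≺z))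
      unique : ∀ w → w ⋖ z → w ≡ z ∧ x
      unique w (w≺z , none) = decidable-stable (w ≟ (z ∧ x))
        (λ ne → none (z ∧ x) ((below w≺z , ne) , z∧x≺z))

  joinIrreducibles : List (Fin n)
  joinIrreducibles = filter joinIrreducible? (allFin n)

  joinIrreducibles-unique : Unique joinIrreducibles
  joinIrreducibles-unique = Unique.filter⁺ joinIrreducible? (Unique.allFin⁺ n)

  ∈-joinIrreducibles : ∀ {p} → JoinIrreducible p → p ∈ joinIrreducibles
  ∈-joinIrreducibles = ∈-filter⁺ joinIrreducible? (∈-allFin _)

  below? : ∀ x p → Dec (p ≼ x)
  below? x p = ≼-dec p x

  support : Fin n → List (Fin n)
  support x = filter (below? x) joinIrreducibles

  support-unique : ∀ x → Unique (support x)
  support-unique x = Unique.filter⁺ (below? x) joinIrreducibles-unique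

  ∈-support : ∀ {p x} → JoinIrreducible p → p ≼ x → p ∈ support x
  ∈-support {x = x} ji = ∈-filter⁺ (below? x) (∈-joinIrreducibles ji)

  ∈-support⁻ : ∀ {p x} → p ∈ support x → JoinIrreducible p × p ≼ x
  ∈-support⁻ {x = x} p∈ =
    let p∈Q , p≼x = ∈-filter⁻ (below? x) {xs = joinIrreducibles} p∈
    in proj₂ (∈-filter⁻ joinIrreducible? {xs = allFin n} p∈Q) , p≼x

  rank : Fin n → ℕ
  rank x = length (support x)

  rank-lowerBound : ∀ {x} ps → Unique ps → All.All (λ p → JoinIrreducible p × p ≼ x) ps →
    length ps ≤ rank x
  rank-lowerBound ps uniq below = length-mono id (λ _ _ e → e) uniq
    (λ p p∈ → let ji , p≼x = All.lookup below p∈ in ∈-support ji p≼x)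

  rank≤∣QL∣ : ∀ x → rank x ≤ ∣QL∣
  rank≤∣QL∣ x = length-mono id (λ _ _ e → e) (support-unique x)
    (λ p → ∈-joinIrreducibles ∘ proj₁ ∘ ∈-support⁻ {p} {x})

  -- A join-irreducible below `y` but not below `x` extends the support of `x`.
  rank-strictMono : ∀ {x y} → x ≺ y → rank x < rank y
  rank-strictMono {x} {y} (x≼y , x≢y) =
    let p , ji , p≼y , p⋠x = joinIrreducible-separates (λ y≼x → x≢y (antisym x≼y y≼x))
    in rank-lowerBound (p ∷ support x)
         (All.tabulate (λ {q} q∈ e → p⋠x (subst (_≼ x) (sym e) (proj₂ (∈-support⁻ q∈))))
           ∷ support-unique x)
         ((ji , p≼y) ∷ All.tabulate (λ {q} q∈ →
           let jq , q≼x = ∈-support⁻ {q} {x} q∈ in jq , ≼-trans q≼x x≼y))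

  joinIrreducible⇒rank≥1 : ∀ {x} → JoinIrreducible x → 1 ≤ rank x
  joinIrreducible⇒rank≥1 {x} ji = rank-lowerBound (x ∷ []) ([] ∷ []) ((ji , ≼-refl) ∷ [])

  -- The only join-irreducible `p` in the support of `x` has rank at least 1 itself, so `p ≺ x`
  -- would push the rank of `x` to at least 2.
  rank≡1⇒joinIrreducible : ∀ {x} → rank x ≡ 1 → JoinIrreducible x
  rank≡1⇒joinIrreducible {x} r≡1 with support x in eq
  ... | p ∷ _ with ∈-support⁻ {p} {x} (subst (p ∈_) (sym eq) (here refl))
  ... | ji , p≼x with p ≟ x
  ... | yes refl = ji
  ... | no p≢x = contradiction
    (ℕₚ.≤-trans (s≤s (joinIrreducible⇒rank≥1 ji)) (rank-strictMono (p≼x , p≢x)))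
    (λ 2≤r → ℕₚ.<⇒≢ 2≤r (trans (sym r≡1) (cong length (sym eq))))

  QL-≡ : {a b : QL} → proj₁ a ≡ proj₁ b → a ≡ b
  QL-≡ {x , s} {.x , t} refl = cong (x ,_) (T-irrelevant s t)

  -- Giving every join-irreducible a colour of its own is proper and distinguishing.
  χ-QL≤∣QL∣ : ∀ {q} → IsChiD _≼Q_ q → q ≤ ∣QL∣
  χ-QL≤∣QL∣ (_ , least) = least ∣QL∣ position
    (λ x y x≢y _ e → x≢y (position-injective e))
    (λ _ _ same x → position-injective (same x))
    where
    position : QL → Fin ∣QL∣
    position (x , t) = index (∈-joinIrreducibles (toWitness t))
    position-injective : ∀ {x y} → position x ≡ position y → x ≡ y
    position-injective {x , s} {y , t} e = QL-≡
      (index-injective (∈-joinIrreducibles (toWitness s)) (∈-joinIrreducibles (toWitness t)) e)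

  -- Automorphisms of the lattice, with the inverse stored as data.

  record Automorphism : Set where
    field
      to from   : Fin n → Fin n
      to∘from   : ∀ x → to (from x) ≡ x
      from∘to   : ∀ x → from (to x) ≡ x
      to-mono   : ∀ {x y} → x ≼ y → to x ≼ to y
      from-mono : ∀ {x y} → x ≼ y → from x ≼ from y

    to-injective : ∀ x y → to x ≡ to y → x ≡ y
    to-injective x y e = trans (sym (from∘to x)) (trans (cong from e) (from∘to y))

    to-reflects : ∀ {x y} → to x ≼ to y → x ≼ y
    to-reflects {x} {y} = subst₂ _≼_ (from∘to x) (from∘to y) ∘ from-mono

    to-≺ : ∀ {x y} → x ≺ y → to x ≺ to y
    to-≺ (x≼y , x≢y) = to-mono x≼y , x≢y ∘ to-injective _ _

  inverse : Automorphism → Automorphism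
  inverse σ = record
    { to = from ; from = to ; to∘from = from∘to ; from∘to = to∘from
    ; to-mono = from-mono ; from-mono = to-mono }
    where open Automorphism σ

  fromIsAutomorphism : ∀ {f} → IsAutomorphism _≼_ f → Automorphism
  fromIsAutomorphism {f} (f-inj , f-surj , f-iff) = record
    { to = f ; from = g ; to∘from = fg ; from∘to = λ x → f-inj _ _ (fg (f x))
    ; to-mono = Equivalence.to (f-iff _ _)
    ; from-mono = λ {x} {y} x≼y →
        Equivalence.from (f-iff _ _) (subst₂ _≼_ (sym (fg x)) (sym (fg y)) x≼y) }
    where
    g : Fin n → Fin n
    g = proj₁ ∘ f-surj
    fg : ∀ x → f (g x) ≡ x
    fg = proj₂ ∘ f-surj

  module _ (σ : Automorphism) where
    open Automorphism σ
    open Automorphism (inverse σ) using () renaming (to-≺ to from-≺)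

    to-⋖ : ∀ {x y} → x ⋖ y → to x ⋖ to y
    to-⋖ (x≺y , none) = to-≺ x≺y , λ z (tx≺z , z≺ty) → none (from z)
      (subst (_≺ from z) (from∘to _) (from-≺ tx≺z) , subst (from z ≺_) (from∘to _) (from-≺ z≺ty))

  to-joinIrreducible : ∀ (σ : Automorphism) {x} →
    JoinIrreducible x → JoinIrreducible (Automorphism.to σ x)
  to-joinIrreducible σ (y , y⋖x , unique) = to y , to-⋖ σ y⋖x , λ z z⋖tx →
    trans (sym (to∘from z))
      (cong to (unique (from z) (subst (from z ⋖_) (from∘to _) (to-⋖ (inverse σ) z⋖tx))))
    where open Automorphism σ

  -- The support of `x` is mapped injectively into that of its image; the same argument for
  -- `inverse σ` turns this into the equality `rank-to`.
  rank-≤-to : ∀ (σ : Automorphism) x → rank x ≤ rank (Automorphism.to σ x)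
  rank-≤-to σ x = length-mono to to-injective (support-unique x)
    (λ p p∈ → let ji , p≼x = ∈-support⁻ p∈ in ∈-support (to-joinIrreducible σ ji) (to-mono p≼x))
    where open Automorphism σ

  rank-to : ∀ (σ : Automorphism) x → rank (Automorphism.to σ x) ≡ rank x
  rank-to σ x = ℕₚ.≤-antisym
    (subst (λ y → rank (to x) ≤ rank y) (from∘to x) (rank-≤-to (inverse σ) (to x)))
    (rank-≤-to σ x)
    where open Automorphism σ

  -- If either inequality between `x` and its image failed, a separating join-irreducible would
  -- witness it, but `σ` fixes that witness.
  fixes-joinIrreducibles⇒identity : ∀ (σ : Automorphism) →
    (∀ {p} → JoinIrreducible p → Automorphism.to σ p ≡ p) → ∀ x → Automorphism.to σ x ≡ x
  fixes-joinIrreducibles⇒identity σ fix x = antisym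
    (decidable-stable (≼-dec _ _) λ ⋠ →
      let p , ji , p≼tx , p⋠x = joinIrreducible-separates ⋠
      in p⋠x (to-reflects (subst (_≼ to x) (sym (fix ji)) p≼tx)))
    (decidable-stable (≼-dec _ _) λ ⋠ →
      let p , ji , p≼x , p⋠tx = joinIrreducible-separates ⋠
      in p⋠tx (subst (_≼ to x) (fix ji) (to-mono p≼x)))
    where open Automorphism σ

-- Colour classes and the atoms below a point.

module Painting (L : FinDistLattice) (k : ℕ)
  (c : FinDistLattice.QL L → Fin (3 + k))
  (c-proper : Proper (FinDistLattice._≼Q_ L) (3 + k) c)
  (c-distinguishing : Distinguishing (FinDistLattice._≼Q_ L) (3 + k) c)
  (2≤∣QL∣ : 2 ≤ FinDistLattice.∣QL∣ L) where
  open Rank L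

  Class : Fin (3 + k) → Fin n → Set
  Class i x = Σ (True (joinIrreducible? x)) λ t → c (x , t) ≡ i

  class? : ∀ i x → Dec (Class i x)
  class? i x with T? _
  ... | no ¬t = no (¬t ∘ proj₁)
  ... | yes t with c (x , t) ≟ i
  ...   | yes e = yes (t , e)
  ...   | no ¬e = no λ (s , e) → ¬e (trans (cong (λ u → c (x , u)) (T-irrelevant t s)) e)

  class-JI : ∀ {i x} → Class i x → JoinIrreducible x
  class-JI = toWitness ∘ proj₁

  class-unique : ∀ {i j x} → Class i x → Class j x → i ≡ j
  class-unique {x = x} (s , e) (t , e′) =
    trans (sym e) (trans (cong (λ u → c (x , u)) (T-irrelevant s t)) e′)

  class-antichain : ∀ {i x y} → Class i x → Class i y → ¬ x ≺ y
  class-antichain (s , e) (t , e′) (x≼y , x≢y) =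
    c-proper (_ , s) (_ , t) (x≢y ∘ cong proj₁) (inj₁ x≼y) (trans e (sym e′))

  -- The join-irreducibles of rank 1 are exactly the atoms.
  AtomBelow : Fin (3 + k) → Fin n → Set
  AtomBelow i x = ∃ λ a → Class i a × rank a ≡ 1 × a ≼ x

  atomBelow? : ∀ i x → Dec (AtomBelow i x)
  atomBelow? i x = any? λ a → class? i a ×-dec (rank a ℕ.≟ 1) ×-dec ≼-dec a x

  atomBelow-mono : ∀ {i x y} → x ≼ y → AtomBelow i x → AtomBelow i y
  atomBelow-mono x≼y (a , ca , ra , a≼x) = a , ca , ra , ≼-trans a≼x x≼y

  -- Classes are antichains, so the atom in question must be `x`.
  atomBelow-own-class : ∀ {i x} → Class i x → AtomBelow i x → rank x ≡ 1
  atomBelow-own-class {x = x} cx (a , ca , ra , a≼x) with a ≟ x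
  ... | yes refl = ra
  ... | no a≢x = contradiction (a≼x , a≢x) (class-antichain ca cx)

  three-classes-below : ∀ {a b d x} → Class 0F a → Class 1F b → Class 2F d →
    a ≼ x → b ≼ x → d ≼ x → 3 ≤ rank x
  three-classes-below {a} {b} {d} ca cb cd a≼x b≼x d≼x = rank-lowerBound (a ∷ b ∷ d ∷ [])
    ( ( (λ { refl → contradiction (class-unique ca cb) λ () })
      ∷ (λ { refl → contradiction (class-unique ca cd) λ () }) ∷ [])
    ∷ ((λ { refl → contradiction (class-unique cb cd) λ () }) ∷ [])
    ∷ [] ∷ [])
    ((class-JI ca , a≼x) ∷ (class-JI cb , b≼x) ∷ (class-JI cd , d≼x) ∷ [])

  -- The hues and the rules that assign them.

  data Hue : Set where
    level : ℕ → Hue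
    class : Fin (2 + k) → Hue

  -- The index is shifted: `Raised i` is applied to points of class `suc i`. It covers every such
  -- point that could lie above a rank 2 point borrowing the colour of that class.
  Raised : Fin (2 + k) → Fin n → Set
  Raised 0F            x = AtomBelow 0F x × 3 ≤ rank x
  Raised 1F            x = AtomBelow 0F x × AtomBelow 1F x
  Raised (suc (suc _)) x = ⊥

  raised? : ∀ i x → Dec (Raised i x)
  raised? 0F            x = atomBelow? 0F x ×-dec (3 ℕ.≤? rank x)
  raised? 1F            x = atomBelow? 0F x ×-dec atomBelow? 1F x
  raised? (suc (suc _)) x = no λ ()

  -- For class 2, the two atoms and `x` itself are join-irreducibles of three different classes.
  raised⇒rank≥3 : ∀ i {x} → Class (suc i) x → Raised i x → 3 ≤ rank x
  raised⇒rank≥3 0F _ (_ , 3≤r) = 3≤r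
  raised⇒rank≥3 1F cx ((a , ca , _ , a≼x) , (b , cb , _ , b≼x)) =
    three-classes-below ca cb cx a≼x b≼x ≼-refl

  raised⇒atomBelow₀ : ∀ i {x} → Raised i x → AtomBelow 0F x
  raised⇒atomBelow₀ 0F = proj₁
  raised⇒atomBelow₀ 1F = proj₁

  data Levelled (x : Fin n) : Set where
    reducible : ¬ JoinIrreducible x → ¬ (rank x ≡ 2 × AtomBelow 0F x) → Levelled x
    class₀    : Class 0F x → rank x ≢ 1 → Levelled x
    raised    : ∀ i → Class (suc i) x → Raised i x → Levelled x

  -- The colouring rule as a relation, so that later arguments match on the rule applied instead of
  -- unfolding `paint`. As in `Raised`, `class i` stands for class `suc i`.
  data Painted (x : Fin n) : Hue → Set where
    atom₀    : Class 0F x → rank x ≡ 1 → Painted x (level 2)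
    levelled : ∀ {r} → Levelled x → rank x ≡ r → Painted x (level r)
    classed  : ∀ i → Class (suc i) x → ¬ Raised i x → Painted x (class i)
    pair     : ¬ JoinIrreducible x → rank x ≡ 2 → AtomBelow 0F x → ¬ AtomBelow 1F x →
               Painted x (class 0F)
    pair₀₁   : ¬ JoinIrreducible x → rank x ≡ 2 → AtomBelow 0F x → AtomBelow 1F x →
               Painted x (class 1F)

  paint : ∀ x → ∃ (Painted x)
  paint x with T? _
  paint x | yes t with c (x , t) in e
  ... | zero with rank x ℕ.≟ 1
  ...   | yes r≡1 = _ , atom₀ (t , e) r≡1
  ...   | no r≢1 = _ , levelled (class₀ (t , e) r≢1) refl
  paint x | yes t | suc i with raised? i x
  ...   | yes up = _ , levelled (raised i (t , e) up) refl
  ...   | no ¬up = _ , classed i (t , e) ¬up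
  paint x | no ¬t with (rank x ℕ.≟ 2) ×-dec atomBelow? 0F x
  ... | no ¬p = _ , levelled (reducible (¬t ∘ fromWitness) ¬p) refl
  ... | yes (r≡2 , a₀) with atomBelow? 1F x
  ...   | yes a₁ = _ , pair₀₁ (¬t ∘ fromWitness) r≡2 a₀ a₁
  ...   | no ¬a₁ = _ , pair (¬t ∘ fromWitness) r≡2 a₀ ¬a₁

  -- Properness of the painting.

  levelled⇒rank≢1 : ∀ {x} → Levelled x → rank x ≢ 1
  levelled⇒rank≢1 (reducible ¬ji _) r≡1 = ¬ji (rank≡1⇒joinIrreducible r≡1)
  levelled⇒rank≢1 (class₀ _ r≢1) = r≢1
  levelled⇒rank≢1 (raised i cx up) r≡1 =
    contradiction (subst (3 ≤_) r≡1 (raised⇒rank≥3 i cx up)) λ { (s≤s ()) }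

  atom-below-rank-2 : ∀ {i x y} → Class i x → x ≺ y → rank y ≡ 2 → rank x ≡ 1
  atom-below-rank-2 cx x≺y ry≡2 = ℕₚ.≤-antisym
    (s≤s⁻¹ (subst (_ ≤_) ry≡2 (rank-strictMono x≺y))) (joinIrreducible⇒rank≥1 (class-JI cx))

  -- Atoms of class 0 share level 2 with levelled points of rank 2. Above such an atom, `reducible`
  -- excludes rank 2 by its own condition, `class₀` contradicts the antichain property, and `raised`
  -- forces rank 3.
  atom₀-below-levelled : ∀ {x y} → Class 0F x → rank x ≡ 1 → x ≺ y →
    Levelled y → rank y ≢ 2
  atom₀-below-levelled cx rx x≺y (reducible _ ¬p) ry = ¬p (ry , _ , cx , rx , proj₁ x≺y)
  atom₀-below-levelled cx rx x≺y (class₀ cy _) ry = class-antichain cx cy x≺y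
  atom₀-below-levelled cx rx x≺y (raised i cy up) ry =
    contradiction (subst (3 ≤_) ry (raised⇒rank≥3 i cy up)) λ { (s≤s (s≤s ())) }

  equal-rank-incomparable : ∀ {x y r} → rank x ≡ r → rank y ≡ r → ¬ x ≺ y
  equal-rank-incomparable refl ry x≺y = ℕₚ.<⇒≢ (rank-strictMono x≺y) (sym ry)

  painted-proper : ∀ {x y h} → Painted x h → Painted y h → ¬ x ≺ y
  painted-proper (atom₀ cx rx) (atom₀ cy ry) = equal-rank-incomparable rx ry
  painted-proper (atom₀ cx rx) (levelled ly ry) x≺y = atom₀-below-levelled cx rx x≺y ly ry
  painted-proper (levelled _ rx) (atom₀ _ ry) x≺y =
    contradiction (subst₂ _<_ rx ry (rank-strictMono x≺y)) λ { (s≤s ()) }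
  painted-proper (levelled _ rx) (levelled _ ry) = equal-rank-incomparable rx ry
  painted-proper (classed i cx _) (classed i cy _) = class-antichain cx cy
  -- Below a point of rank 2, `x` would be an atom of class 1, which `pair` forbids.
  painted-proper (classed i cx _) (pair _ ry _ ¬a₁) x≺y =
    ¬a₁ (_ , cx , atom-below-rank-2 cx x≺y ry , proj₁ x≺y)
  -- Here `x` has class 2 and joins the atoms of classes 0 and 1 below `y`, too many for rank 2.
  painted-proper (classed i cx _) (pair₀₁ _ ry (a , ca , _ , a≼y) (b , cb , _ , b≼y)) x≺y =
    contradiction (subst (3 ≤_) ry (three-classes-below ca cb cx a≼y b≼y (proj₁ x≺y)))
      λ { (s≤s (s≤s ())) }
  -- Lying above `x`, the point `y` inherits its atom of class 0 and has rank at least 3, so it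
  -- would have been raised.
  painted-proper (pair _ rx a₀ _) (classed i _ ¬up) x≺y =
    ¬up (atomBelow-mono (proj₁ x≺y) a₀ , subst (_< _) rx (rank-strictMono x≺y))
  painted-proper (pair₀₁ _ rx a₀ a₁) (classed i _ ¬up) x≺y =
    ¬up (atomBelow-mono (proj₁ x≺y) a₀ , atomBelow-mono (proj₁ x≺y) a₁)
  painted-proper (pair _ rx _ _) (pair _ ry _ _) = equal-rank-incomparable rx ry
  painted-proper (pair₀₁ _ rx _ _) (pair₀₁ _ ry _ _) = equal-rank-incomparable rx ry

  -- Hue-preserving automorphisms are trivial.

  SameAtomsBelow : Fin n → Fin n → Set
  SameAtomsBelow x y = ∀ i → (AtomBelow i x → AtomBelow i y) × (AtomBelow i y → AtomBelow i x)

  SameClass : Fin n → Fin n → Set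
  SameClass x y = ∃ λ i → Class i x × Class i y

  -- A raised join-irreducible of class 1 lies above an atom of class 0, one of class 2 lies
  -- above atoms of classes 0 and 1, and no non-atom lies above an atom of its own class.
  levelled-sameClass : ∀ {x y} → JoinIrreducible x → JoinIrreducible y → rank x ≡ rank y →
    SameAtomsBelow x y → Levelled x → Levelled y → SameClass x y
  levelled-sameClass jx _ _ _ (reducible ¬jx _) _ = contradiction jx ¬jx
  levelled-sameClass _ jy _ _ _ (reducible ¬jy _) = contradiction jy ¬jy
  levelled-sameClass _ _ _ _ (class₀ cx _) (class₀ cy _) = _ , cx , cy
  levelled-sameClass _ _ _ same (class₀ cx rx) (raised i _ up) =
    contradiction (atomBelow-own-class cx (proj₂ (same 0F) (raised⇒atomBelow₀ i up))) rx
  levelled-sameClass _ _ _ same (raised i _ up) (class₀ cy ry) =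
    contradiction (atomBelow-own-class cy (proj₁ (same 0F) (raised⇒atomBelow₀ i up))) ry
  levelled-sameClass _ _ _ _ (raised 0F cx _) (raised 0F cy _) = _ , cx , cy
  levelled-sameClass _ _ _ _ (raised 1F cx _) (raised 1F cy _) = _ , cx , cy
  levelled-sameClass _ _ _ same lx@(raised 0F cx _) (raised 1F _ (_ , a₁)) =
    contradiction (atomBelow-own-class cx (proj₂ (same 1F) a₁)) (levelled⇒rank≢1 lx)
  levelled-sameClass _ _ _ same (raised 1F _ (_ , a₁)) ly@(raised 0F cy _) =
    contradiction (atomBelow-own-class cy (proj₁ (same 1F) a₁)) (levelled⇒rank≢1 ly)

  -- Agreement on atoms below is demanded only off rank 1. This avoids circularity: the lemma first
  -- shows that atoms keep their classes, and that fact then supplies the hypothesis for the other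
  -- join-irreducibles.
  painted-sameClass : ∀ {x y h} → JoinIrreducible x → JoinIrreducible y → rank x ≡ rank y →
    (rank x ≢ 1 → SameAtomsBelow x y) → Painted x h → Painted y h → SameClass x y
  painted-sameClass _ _ _ _ (atom₀ cx _) (atom₀ cy _) = _ , cx , cy
  painted-sameClass _ _ rx≡ry _ (atom₀ _ rx) (levelled ly _) =
    contradiction (trans (sym rx≡ry) rx) (levelled⇒rank≢1 ly)
  painted-sameClass _ _ rx≡ry _ (levelled lx _) (atom₀ _ ry) =
    contradiction (trans rx≡ry ry) (levelled⇒rank≢1 lx)
  painted-sameClass jx jy rx≡ry same (levelled lx _) (levelled ly _) =
    levelled-sameClass jx jy rx≡ry (same (levelled⇒rank≢1 lx)) lx ly
  painted-sameClass _ _ _ _ (classed i cx _) (classed i cy _) = _ , cx , cy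
  painted-sameClass jx _ _ _ (pair ¬jx _ _ _) _ = contradiction jx ¬jx
  painted-sameClass jx _ _ _ (pair₀₁ ¬jx _ _ _) _ = contradiction jx ¬jx
  painted-sameClass _ jy _ _ _ (pair ¬jy _ _ _) = contradiction jy ¬jy
  painted-sameClass _ jy _ _ _ (pair₀₁ ¬jy _ _ _) = contradiction jy ¬jy

  hue : Fin n → Hue
  hue x = proj₁ (paint x)

  PreservesHue : Automorphism → Set
  PreservesHue σ = ∀ x → hue (Automorphism.to σ x) ≡ hue x

  inverse-preservesHue : ∀ σ → PreservesHue σ → PreservesHue (inverse σ)
  inverse-preservesHue σ same x = trans (sym (same (from x))) (cong hue (to∘from x))
    where open Automorphism σ

  sameClass⇒ : ∀ {i x y} → SameClass x y → Class i x → Class i y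
  sameClass⇒ (j , cx , cy) cx′ = subst (λ i → Class i _) (class-unique cx cx′) cy

  to-sameClass : ∀ σ → PreservesHue σ → ∀ {x} → JoinIrreducible x →
    (rank x ≢ 1 → SameAtomsBelow x (Automorphism.to σ x)) → SameClass x (Automorphism.to σ x)
  to-sameClass σ same {x} ji atoms =
    painted-sameClass ji (to-joinIrreducible σ ji) (sym (rank-to σ x)) atoms
      (proj₂ (paint x)) (subst (Painted _) (same x) (proj₂ (paint _)))

  to-atomBelow : ∀ σ → PreservesHue σ → ∀ {i x} →
    AtomBelow i x → AtomBelow i (Automorphism.to σ x)
  to-atomBelow σ same (a , ca , ra , a≼x) =
    -- As `a` has rank 1, the hypothesis on atoms below is vacuous.
    to a , sameClass⇒ (to-sameClass σ same (class-JI ca) (contradiction ra)) ca ,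
    trans (rank-to σ a) ra , to-mono a≼x
    where open Automorphism σ

  to-preserves-class : ∀ σ → PreservesHue σ → ∀ {i x} → Class i x → Class i (Automorphism.to σ x)
  to-preserves-class σ same {x = x} cx = sameClass⇒
    (to-sameClass σ same (class-JI cx) λ _ i →
      to-atomBelow σ same ,
      subst (AtomBelow i) (Automorphism.from∘to σ x)
        ∘ to-atomBelow (inverse σ) (inverse-preservesHue σ same))
    cx

  -- Since classes are preserved, `σ` restricts to a `c`-preserving automorphism of the
  -- join-irreducibles, which `c` forces to be trivial.
  preservesHue⇒identity : ∀ σ → PreservesHue σ → ∀ x → Automorphism.to σ x ≡ x
  preservesHue⇒identity σ same = fixes-joinIrreducibles⇒identity σ λ ji →
    cong proj₁ (c-distinguishing restriction
      ( (λ a b e → QL-≡ (to-injective _ _ (cong proj₁ e)))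
      , (λ (y , t) →
          ( from y , fromWitness (to-joinIrreducible (inverse σ) (toWitness t)))
          , QL-≡ (to∘from y))
      , (λ _ _ → mk⇔ to-mono to-reflects))
      (λ (x , t) → class-unique (_ , refl) (to-preserves-class σ same (t , refl)))
      (_ , fromWitness ji))
    where
    open Automorphism σ
    restriction : QL → QL
    restriction (x , t) = to x , fromWitness (to-joinIrreducible σ (toWitness t))

  -- Numbering the hues.

  -- No hue is level 1, so shifting the positive levels down by one merges no two hues.
  code : Hue → ℕ
  code (level r) = pred r
  code (class i) = ∣QL∣ + toℕ i

  ∣QL∣>0 : 0 < ∣QL∣
  ∣QL∣>0 = ℕₚ.<-trans (s≤s z≤n) 2≤∣QL∣

  -- The level 2 of an atom of class 0 is not its rank, so its bound comes from `2≤∣QL∣` instead of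
  -- `rank≤∣QL∣`.
  painted-level : ∀ {x r} → Painted x (level r) → r ≢ 1 × r ≤ ∣QL∣
  painted-level (atom₀ _ _) = (λ ()) , 2≤∣QL∣
  painted-level {x} (levelled lx refl) = levelled⇒rank≢1 lx , rank≤∣QL∣ x

  -- Level 0 keeps code 0, hence the positivity hypothesis.
  pred-< : ∀ {r m} → 0 < m → r ≤ m → pred r < m
  pred-< {zero}  0<m _   = 0<m
  pred-< {suc r} _   r<m = r<m

  pred-injective : ∀ {r s} → r ≢ 1 → s ≢ 1 → pred r ≡ pred s → r ≡ s
  pred-injective {zero}        {zero}        _   _   _    = refl
  pred-injective {zero}        {suc zero}    _   s≢1 _    = contradiction refl s≢1
  pred-injective {suc zero}    {zero}        r≢1 _   _    = contradiction refl r≢1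
  pred-injective {suc r}       {suc .r}      _   _   refl = refl

  level-code< : ∀ {x r} → Painted x (level r) → code (level r) < ∣QL∣
  level-code< = pred-< ∣QL∣>0 ∘ proj₂ ∘ painted-level

  code< : ∀ {x} h → Painted x h → code h < ∣QL∣ + (2 + k)
  code< (level r) p = ℕₚ.≤-trans (level-code< p) (ℕₚ.m≤m+n _ _)
  code< (class i) _ = ℕₚ.+-monoʳ-< ∣QL∣ (toℕ<n i)

  code-injective : ∀ {x y} h h′ → Painted x h → Painted y h′ → code h ≡ code h′ → h ≡ h′
  code-injective (level r) (level s) p p′ e =
    cong level (pred-injective (proj₁ (painted-level p)) (proj₁ (painted-level p′)) e)
  code-injective (level r) (class i) p _ e =
    contradiction e (ℕₚ.<⇒≢ (ℕₚ.≤-trans (level-code< p) (ℕₚ.m≤m+n _ _)))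
  code-injective (class i) (level s) _ p e =
    contradiction (sym e) (ℕₚ.<⇒≢ (ℕₚ.≤-trans (level-code< p) (ℕₚ.m≤m+n _ _)))
  code-injective (class i) (class j) _ _ e =
    cong class (toℕ-injective (ℕₚ.+-cancelˡ-≡ ∣QL∣ _ _ e))

  -- Levels 0 to `∣QL∣` without level 1 take `∣QL∣` colours, and the classes other than 0 take the
  -- remaining `2 + k`.
  colour : Fin n → Fin (∣QL∣ + (2 + k))
  colour x = fromℕ< (code< (hue x) (proj₂ (paint x)))

  colour≡⇒hue≡ : ∀ {x y} → colour x ≡ colour y → hue x ≡ hue y
  colour≡⇒hue≡ {x} {y} e = code-injective (hue x) (hue y) (proj₂ (paint x)) (proj₂ (paint y))
    (fromℕ<-injective _ _ (code< (hue x) (proj₂ (paint x))) (code< (hue y) (proj₂ (paint y))) e)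

  colour-≺ : ∀ {x y} → x ≺ y → colour x ≢ colour y
  colour-≺ {x} {y} x≺y e =
    painted-proper (subst (Painted x) (colour≡⇒hue≡ e) (proj₂ (paint x))) (proj₂ (paint y)) x≺y

  colour-proper : Proper _≼_ (∣QL∣ + (2 + k)) colour
  colour-proper x y x≢y (inj₁ x≼y) = colour-≺ (x≼y , x≢y)
  colour-proper x y x≢y (inj₂ y≼x) = colour-≺ (y≼x , x≢y ∘ sym) ∘ sym

  colour-distinguishing : Distinguishing _≼_ (∣QL∣ + (2 + k)) colour
  colour-distinguishing f f-auto same =
    preservesHue⇒identity (fromIsAutomorphism f-auto) (λ x → colour≡⇒hue≡ (same x))

theorem4p7 : (L : FinDistLattice) → (q l : ℕ) →
    IsChiD (FinDistLattice._≼Q_ L) q → 3 ≤ q →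
    IsChiD (FinDistLattice._≼_ L) l →
    l ≤ FinDistLattice.∣QL∣ L + q ∸ 1
theorem4p7 L (suc (suc (suc k))) l χQ@((c , c-proper , c-dist) , _) (s≤s (s≤s (s≤s z≤n))) (_ , least) =
  -- With `q` equal to `3 + k`, `+-suc` exposes the successor that the truncated subtraction
  -- removes.
  subst (l ≤_) (cong (_∸ 1) (sym (ℕₚ.+-suc ∣QL∣ (2 + k))))
    (least _ colour colour-proper colour-distinguishing)
  where
  open Rank L
  open Painting L k c c-proper c-dist
    -- There are at least `q`, hence at least 2, join-irreducibles.
    (ℕₚ.≤-trans (s≤s (s≤s z≤n)) (χ-QL≤∣QL∣ χQ))
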